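{- Let $\Pi$ be a nested logic program, $\hat\Pi=\{B(r)\supset H(r)\mid r\in\Pi\}$, $V=\mathrm{var}(\Pi)$, and $I\subseteq V$. Then $I$ is a stable model of $\Pi$ if and only if $I'$ is a model of $$\mathcal{S}[\Pi]=\hat\Pi'\wedge\neg\exists V\Big((V<V')\wedge\bigwedge_{r\in\Pi}\big(\tau[B(r)]\supset\tau[H(r)]\big)\Big).$$
   Context: Formulas are built from atoms, $\top,\bot$, and $\neg,\wedge,\vee,\supset$; an expression is a formula without $\supset$. A classical interpretation is a set $I$ of atoms ($p$ is true iff $p\in I$). A finite set of formulas is identified with the conjunction of its elements (empty conjunction $=\top$). Programs: a rule $r$ is a pair $H(r)\leftarrow B(r)$ of expressions; a (nested logic) program is a finite set of rules; $\mathrm{var}(\Pi)$ is the set of atoms occurring in $\Pi$. A program is basic if it contains no $\neg$; $I$ is a model of a basic program $\Pi$ iff it is a classical model of $\hat\Pi$. The reduct $\Pi^I$ is obtained from $\Pi$ by replacing every occurrence of an expression $\neg\psi$ not in the scope of another negation by $\top$ if $\neg\psi$ is classically true under $I$, and by $\bot$ otherwise. $I$ is a stable model of $\Pi$ iff $I$ is a minimal (w.r.t. $\subseteq$) model of $\Pi^I$. Priming: for each atom $p$, $p'$ is a globally new atom; $\varphi'$ replaces every atom $p$ of $\varphi$ by $p'$; similarly for sets of formulas; for a set $I$ of atoms, $I'=\{p'\mid p\in I\}$ (likewise $V'$). QBFs extend propositional formulas by quantifiers over atoms: under $I$, $\forall p\,\Psi$ is true iff both $\Psi[p/\top]$ and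 $\Psi[p/\bot]$ are true, $\exists p\,\Psi$ iff at least one is. $I$ is a model of $\Phi$ if $\Phi$ is true under $I$. $\exists P\,\Phi$ for a finite set $P$ of atoms quantifies all atoms of $P$. For indexed sets $S=\{\varphi_i\}$, $T=\{\psi_i\}$ of $n$ formulas, $S\le T$ abbreviates $\bigwedge_{i}(\varphi_i\supset\psi_i)$ and $S<T$ abbreviates $(S\le T)\wedge\neg(T\le S)$; in $V<V'$ the atom $p$ is paired with $p'$. The translation $\tau[\cdot]$ (on expressions): $\tau[\varphi]=\varphi$ if $\varphi$ is an atom, $\top$ or $\bot$; $\tau[\varphi_1\circ\varphi_2]=\tau[\varphi_1]\circ\tau[\varphi_2]$ for $\circ\in\{\wedge,\vee\}$; $\tau[\neg\psi]=\neg\psi'$. -}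

module Defs where

open import Level using (Level)
open import Data.Bool.Base as 𝔹 using (Bool; true; false; if_then_else_)
open import Data.List.Base using (List; []; _∷_; _++_; map; foldr; concatMap; deduplicate)
open import Data.List.Membership.Propositional using (_∈_)
open import Data.List.Relation.Unary.All as All using (All)
open import Data.Nat.Base using (ℕ; zero; suc; _⊔_; s≤s) renaming (_≤_ to _≤ℕ_)
open import Data.Nat.Properties using (≤-refl; m⊔n≤o⇒m≤o; m⊔n≤o⇒n≤o)
open import Data.Product.Base using (_×_; _,_)
open import Data.Vec.Base as Vec using (Vec)
open import Relation.Binary.Definitions using (DecidableEquality)
open import Relation.Binary.PropositionalEquality using (_≡_; refl; sym; trans; cong; cong₂; subst)
open import Relation.Nullary using (yes; no)

private
  variable
    a b : Level
    A : Set a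
    B : Set b

infix  9 ¬_
infixr 8 _∧_
infixr 7 _∨_
infixr 6 _⊃_
infix  5 _←_

data Expr (A : Set a) : Set a where
  atom    : A → Expr A
  ⊤ ⊥     : Expr A
  ¬_      : Expr A → Expr A
  _∧_ _∨_ : Expr A → Expr A → Expr A

data Formula (A : Set a) : Set a where
  atom        : A → Formula A
  ⊤ ⊥         : Formula A
  ¬_          : Formula A → Formula A
  _∧_ _∨_ _⊃_ : Formula A → Formula A → Formula A

data QBF (A : Set a) : Set a where
  atom        : A → QBF A
  ⊤ ⊥         : QBF A
  ¬_          : QBF A → QBF A
  _∧_ _∨_ _⊃_ : QBF A → QBF A → QBF A
  all ex      : A → QBF A → QBF A

⌜_⌝ : Expr A → Formula A
⌜ atom p ⌝ = atom p
⌜ ⊤ ⌝      = ⊤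
⌜ ⊥ ⌝      = ⊥
⌜ ¬ φ ⌝    = ¬ ⌜ φ ⌝
⌜ φ ∧ ψ ⌝  = ⌜ φ ⌝ ∧ ⌜ ψ ⌝
⌜ φ ∨ ψ ⌝  = ⌜ φ ⌝ ∨ ⌜ ψ ⌝

toQBF : Formula A → QBF A
toQBF (atom p) = atom p
toQBF ⊤        = ⊤
toQBF ⊥        = ⊥
toQBF (¬ φ)    = ¬ toQBF φ
toQBF (φ ∧ ψ)  = toQBF φ ∧ toQBF ψ
toQBF (φ ∨ ψ)  = toQBF φ ∨ toQBF ψ
toQBF (φ ⊃ ψ)  = toQBF φ ⊃ toQBF ψ

⋀ : List (Formula A) → Formula A
⋀ = foldr _∧_ ⊤

-- A set of atoms, given by its characteristic function; Bool-valued because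
-- classically every atom is either in the set or not.
Interpretation : Set a → Set a
Interpretation A = A → Bool

infix 4 _∈ᴵ_ _⊆_ _⊆ᴸ_ _⊨_

_∈ᴵ_ : A → Interpretation A → Set
p ∈ᴵ I = I p ≡ true

_⊆_ : {A : Set a} → Interpretation A → Interpretation A → Set a
I ⊆ J = ∀ {p} → p ∈ᴵ I → p ∈ᴵ J

_⊆ᴸ_ : {A : Set a} → Interpretation A → List A → Set a
I ⊆ᴸ V = ∀ {p} → p ∈ᴵ I → p ∈ V

⟦_⟧ : Formula A → Interpretation A → Bool
⟦ atom p ⟧ I = I p
⟦ ⊤ ⟧      I = true
⟦ ⊥ ⟧      I = false
⟦ ¬ φ ⟧    I = 𝔹.not (⟦ φ ⟧ I)
⟦ φ ∧ ψ ⟧  I = ⟦ φ ⟧ I 𝔹.∧ ⟦ ψ ⟧ I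
⟦ φ ∨ ψ ⟧  I = ⟦ φ ⟧ I 𝔹.∨ ⟦ ψ ⟧ I
⟦ φ ⊃ ψ ⟧  I = 𝔹.not (⟦ φ ⟧ I) 𝔹.∨ ⟦ ψ ⟧ I

_⊨_ : Interpretation A → Formula A → Set
I ⊨ φ = ⟦ φ ⟧ I ≡ true

record Rule (A : Set a) : Set a where
  constructor _←_
  field
    head body : Expr A

open Rule public

Program : Set a → Set a
Program A = List (Rule A)

atoms : Expr A → List A
atoms (atom p) = p ∷ []
atoms ⊤        = []
atoms ⊥        = []
atoms (¬ φ)    = atoms φ
atoms (φ ∧ ψ)  = atoms φ ++ atoms ψ
atoms (φ ∨ ψ)  = atoms φ ++ atoms ψ

var : {A : Set a} → DecidableEquality A → Program A → List A
var _≟_ Π = deduplicate _≟_ (concatMap (λ r → atoms (head r) ++ atoms (body r)) Π)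

hat : Program A → List (Formula A)
hat = map (λ r → ⌜ body r ⌝ ⊃ ⌜ head r ⌝)

data Basic {A : Set a} : Expr A → Set a where
  atom    : (p : A) → Basic (atom p)
  ⊤       : Basic ⊤
  ⊥       : Basic ⊥
  _∧_     : ∀ {φ ψ} → Basic φ → Basic ψ → Basic (φ ∧ ψ)
  _∨_     : ∀ {φ ψ} → Basic φ → Basic ψ → Basic (φ ∨ ψ)

BasicProgram : {A : Set a} → Program A → Set a
BasicProgram = All (λ r → Basic (head r) × Basic (body r))

-- Only outermost negations are replaced, so there is no recursion under ¬_.
reductᴱ : Interpretation A → Expr A → Expr A
reductᴱ I (atom p) = atom p
reductᴱ I ⊤        = ⊤
reductᴱ I ⊥        = ⊥
reductᴱ I (¬ ψ)    = if ⟦ ⌜ ¬ ψ ⌝ ⟧ I then ⊤ else ⊥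
reductᴱ I (φ ∧ ψ)  = reductᴱ I φ ∧ reductᴱ I ψ
reductᴱ I (φ ∨ ψ)  = reductᴱ I φ ∨ reductᴱ I ψ

reduct : Interpretation A → Program A → Program A
reduct I = map (λ r → reductᴱ I (head r) ← reductᴱ I (body r))

reductᴱ-basic : (I : Interpretation A) (φ : Expr A) → Basic (reductᴱ I φ)
reductᴱ-basic I (atom p) = atom p
reductᴱ-basic I ⊤        = ⊤
reductᴱ-basic I ⊥        = ⊥
reductᴱ-basic I (¬ ψ) with ⟦ ⌜ ¬ ψ ⌝ ⟧ I
... | true  = ⊤
... | false = ⊥
reductᴱ-basic I (φ ∧ ψ)  = reductᴱ-basic I φ ∧ reductᴱ-basic I ψ
reductᴱ-basic I (φ ∨ ψ)  = reductᴱ-basic I φ ∨ reductᴱ-basic I ψ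

reduct-basic : (I : Interpretation A) (Π : Program A) → BasicProgram (reduct I Π)
reduct-basic I []      = All.[]
reduct-basic I (r ∷ Π) =
  (reductᴱ-basic I (head r) , reductᴱ-basic I (body r)) All.∷ reduct-basic I Π

-- The notion of model for basic programs; it is only ever applied to reducts,
-- which are basic by reduct-basic.
IsModel : Interpretation A → Program A → Set
IsModel I Π = I ⊨ ⋀ (hat Π)

IsMinimalModel : {A : Set a} → Interpretation A → Program A → Set a
IsMinimalModel I Π = IsModel I Π × (∀ J → IsModel J Π → J ⊆ I → I ⊆ J)

IsStableModel : {A : Set a} → Interpretation A → Program A → Set a
IsStableModel I Π = IsMinimalModel I (reduct I Π)

-- The alphabet extended by a new atom p ′ for each original atom p; the
-- original atom p itself is ⌊ p ⌋ there.
infix 10 _′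

data Primed (A : Set a) : Set a where
  ⌊_⌋ _′ : A → Primed A

primed-≟ : {A : Set a} → DecidableEquality A → DecidableEquality (Primed A)
primed-≟ _≟_ ⌊ p ⌋ ⌊ q ⌋ with p ≟ q
... | yes refl = yes refl
... | no p≢q   = no λ { refl → p≢q refl }
primed-≟ _≟_ ⌊ p ⌋ (q ′) = no λ ()
primed-≟ _≟_ (p ′) ⌊ q ⌋ = no λ ()
primed-≟ _≟_ (p ′) (q ′) with p ≟ q
... | yes refl = yes refl
... | no p≢q   = no λ { refl → p≢q refl }

primeᴱ : Expr A → Expr (Primed A)
primeᴱ (atom p) = atom (p ′)
primeᴱ ⊤        = ⊤
primeᴱ ⊥        = ⊥
primeᴱ (¬ φ)    = ¬ primeᴱ φ
primeᴱ (φ ∧ ψ)  = primeᴱ φ ∧ primeᴱ ψ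
primeᴱ (φ ∨ ψ)  = primeᴱ φ ∨ primeᴱ ψ

primeᶠ : Formula A → Formula (Primed A)
primeᶠ (atom p) = atom (p ′)
primeᶠ ⊤        = ⊤
primeᶠ ⊥        = ⊥
primeᶠ (¬ φ)    = ¬ primeᶠ φ
primeᶠ (φ ∧ ψ)  = primeᶠ φ ∧ primeᶠ ψ
primeᶠ (φ ∨ ψ)  = primeᶠ φ ∨ primeᶠ ψ
primeᶠ (φ ⊃ ψ)  = primeᶠ φ ⊃ primeᶠ ψ

primeᴵ : Interpretation A → Interpretation (Primed A)
primeᴵ I ⌊ p ⌋ = false
primeᴵ I (p ′) = I p

τ : Expr A → Expr (Primed A)
τ (atom p) = atom ⌊ p ⌋
τ ⊤        = ⊤
τ ⊥        = ⊥
τ (¬ ψ)    = ¬ primeᴱ ψ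
τ (φ ∧ ψ)  = τ φ ∧ τ ψ
τ (φ ∨ ψ)  = τ φ ∨ τ ψ

infix 5 _≤_ _<_

_≤_ : ∀ {n} → Vec (Formula A) n → Vec (Formula A) n → Formula A
S ≤ T = ⋀ (Vec.toList (Vec.zipWith _⊃_ S T))

_<_ : ∀ {n} → Vec (Formula A) n → Vec (Formula A) n → Formula A
S < T = (S ≤ T) ∧ ¬ (T ≤ S)

exists : List A → QBF A → QBF A
exists P Φ = foldr ex Φ P

rank : QBF A → ℕ
rank (atom p)  = 0
rank ⊤         = 0
rank ⊥         = 0
rank (¬ Φ)     = rank Φ
rank (Φ ∧ Ψ)   = rank Φ ⊔ rank Ψ
rank (Φ ∨ Ψ)   = rank Φ ⊔ rank Ψ
rank (Φ ⊃ Ψ)   = rank Φ ⊔ rank Ψ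
rank (all p Φ) = suc (rank Φ)
rank (ex p Φ)  = suc (rank Φ)

module QBFSemantics {a} {A : Set a} (_≟_ : DecidableEquality A) where

  -- Φ [ p / true ] and Φ [ p / false ] replace the free occurrences of p by ⊤
  -- and by ⊥, respectively.
  infix 10 _[_/_]

  _[_/_] : QBF A → A → Bool → QBF A
  atom q [ p / v ] with p ≟ q
  ... | yes _ = if v then ⊤ else ⊥
  ... | no  _ = atom q
  ⊤ [ p / v ]       = ⊤
  ⊥ [ p / v ]       = ⊥
  (¬ Φ) [ p / v ]   = ¬ (Φ [ p / v ])
  (Φ ∧ Ψ) [ p / v ] = Φ [ p / v ] ∧ Ψ [ p / v ]
  (Φ ∨ Ψ) [ p / v ] = Φ [ p / v ] ∨ Ψ [ p / v ]
  (Φ ⊃ Ψ) [ p / v ] = Φ [ p / v ] ⊃ Ψ [ p / v ]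
  all q Φ [ p / v ] with p ≟ q
  ... | yes _ = all q Φ
  ... | no  _ = all q (Φ [ p / v ])
  ex q Φ [ p / v ] with p ≟ q
  ... | yes _ = ex q Φ
  ... | no  _ = ex q (Φ [ p / v ])

  rank-[/] : ∀ Φ p v → rank (Φ [ p / v ]) ≡ rank Φ
  rank-[/] (atom q) p v with p ≟ q
  rank-[/] (atom q) p true  | yes _ = refl
  rank-[/] (atom q) p false | yes _ = refl
  rank-[/] (atom q) p v     | no  _ = refl
  rank-[/] ⊤ p v       = refl
  rank-[/] ⊥ p v       = refl
  rank-[/] (¬ Φ) p v   = rank-[/] Φ p v
  rank-[/] (Φ ∧ Ψ) p v = cong₂ _⊔_ (rank-[/] Φ p v) (rank-[/] Ψ p v)
  rank-[/] (Φ ∨ Ψ) p v = cong₂ _⊔_ (rank-[/] Φ p v) (rank-[/] Ψ p v)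
  rank-[/] (Φ ⊃ Ψ) p v = cong₂ _⊔_ (rank-[/] Φ p v) (rank-[/] Ψ p v)
  rank-[/] (all q Φ) p v with p ≟ q
  ... | yes _ = refl
  ... | no  _ = cong suc (rank-[/] Φ p v)
  rank-[/] (ex q Φ) p v with p ≟ q
  ... | yes _ = refl
  ... | no  _ = cong suc (rank-[/] Φ p v)

  [/]-≤ : ∀ {n} Φ p v → rank Φ ≤ℕ n → rank (Φ [ p / v ]) ≤ℕ n
  [/]-≤ {n} Φ p v = subst (_≤ℕ n) (sym (rank-[/] Φ p v))

  -- Φ [ p / v ] is not a subterm of all p Φ, so the recursion is on a bound n
  -- for the quantifier rank; the bound does not affect the value (truth-≡).
  truth : Interpretation A → (n : ℕ) (Φ : QBF A) → rank Φ ≤ℕ n → Bool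
  truth I n (atom p) _ = I p
  truth I n ⊤ _        = true
  truth I n ⊥ _        = false
  truth I n (¬ Φ) h    = 𝔹.not (truth I n Φ h)
  truth I n (Φ ∧ Ψ) h  =
    truth I n Φ (m⊔n≤o⇒m≤o _ _ h) 𝔹.∧ truth I n Ψ (m⊔n≤o⇒n≤o (rank Φ) _ h)
  truth I n (Φ ∨ Ψ) h  =
    truth I n Φ (m⊔n≤o⇒m≤o _ _ h) 𝔹.∨ truth I n Ψ (m⊔n≤o⇒n≤o (rank Φ) _ h)
  truth I n (Φ ⊃ Ψ) h  =
    𝔹.not (truth I n Φ (m⊔n≤o⇒m≤o _ _ h)) 𝔹.∨ truth I n Ψ (m⊔n≤o⇒n≤o (rank Φ) _ h)
  truth I (suc n) (all p Φ) (s≤s h) =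
    truth I n (Φ [ p / true ]) ([/]-≤ Φ p true h) 𝔹.∧
    truth I n (Φ [ p / false ]) ([/]-≤ Φ p false h)
  truth I (suc n) (ex p Φ) (s≤s h) =
    truth I n (Φ [ p / true ]) ([/]-≤ Φ p true h) 𝔹.∨
    truth I n (Φ [ p / false ]) ([/]-≤ Φ p false h)

  ⟦_⟧ꟴ : QBF A → Interpretation A → Bool
  ⟦ Φ ⟧ꟴ I = truth I (rank Φ) Φ ≤-refl

  infix 4 _⊨ꟴ_

  _⊨ꟴ_ : Interpretation A → QBF A → Set
  I ⊨ꟴ Φ = ⟦ Φ ⟧ꟴ I ≡ true

  truth-≡ : ∀ I m n Φ h k → truth I m Φ h ≡ truth I n Φ k
  truth-≡ I m n (atom p) h k = refl
  truth-≡ I m n ⊤ h k        = refl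
  truth-≡ I m n ⊥ h k        = refl
  truth-≡ I m n (¬ Φ) h k    = cong 𝔹.not (truth-≡ I m n Φ h k)
  truth-≡ I m n (Φ ∧ Ψ) h k  = cong₂ 𝔹._∧_ (truth-≡ I m n Φ _ _) (truth-≡ I m n Ψ _ _)
  truth-≡ I m n (Φ ∨ Ψ) h k  = cong₂ 𝔹._∨_ (truth-≡ I m n Φ _ _) (truth-≡ I m n Ψ _ _)
  truth-≡ I m n (Φ ⊃ Ψ) h k  =
    cong₂ 𝔹._∨_ (cong 𝔹.not (truth-≡ I m n Φ _ _)) (truth-≡ I m n Ψ _ _)
  truth-≡ I (suc m) (suc n) (all p Φ) (s≤s h) (s≤s k) =
    cong₂ 𝔹._∧_ (truth-≡ I m n (Φ [ p / true ]) _ _) (truth-≡ I m n (Φ [ p / false ]) _ _)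
  truth-≡ I (suc m) (suc n) (ex p Φ) (s≤s h) (s≤s k) =
    cong₂ 𝔹._∨_ (truth-≡ I m n (Φ [ p / true ]) _ _) (truth-≡ I m n (Φ [ p / false ]) _ _)

  ⟦all⟧ : ∀ I p Φ → ⟦ all p Φ ⟧ꟴ I ≡ ⟦ Φ [ p / true ] ⟧ꟴ I 𝔹.∧ ⟦ Φ [ p / false ] ⟧ꟴ I
  ⟦all⟧ I p Φ =
    trans (truth-≡ I _ _ (all p Φ) ≤-refl (s≤s ≤-refl))
      (cong₂ 𝔹._∧_ (truth-≡ I _ _ (Φ [ p / true ]) _ _) (truth-≡ I _ _ (Φ [ p / false ]) _ _))

  ⟦ex⟧ : ∀ I p Φ → ⟦ ex p Φ ⟧ꟴ I ≡ ⟦ Φ [ p / true ] ⟧ꟴ I 𝔹.∨ ⟦ Φ [ p / false ] ⟧ꟴ I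
  ⟦ex⟧ I p Φ =
    trans (truth-≡ I _ _ (ex p Φ) ≤-refl (s≤s ≤-refl))
      (cong₂ 𝔹._∨_ (truth-≡ I _ _ (Φ [ p / true ]) _ _) (truth-≡ I _ _ (Φ [ p / false ]) _ _))

𝒮[_] : {A : Set a} → DecidableEquality A → Program A → QBF (Primed A)
𝒮[ _≟_ ] Π =
  toQBF (⋀ (map primeᶠ (hat Π))) ∧
  ¬ exists (map ⌊_⌋ V) (toQBF (
      (Vec.map (λ p → atom ⌊ p ⌋) (Vec.fromList V) < Vec.map (λ p → atom (p ′)) (Vec.fromList V)) ∧
      ⋀ (map (λ r → ⌜ τ (body r) ⌝ ⊃ ⌜ τ (head r) ⌝) Π)))
  where V = var _≟_ Π

{-# OPTIONS --safe #-}
module Submission where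

-- Interpretations of the extended alphabet split into a part J on the original
-- atoms and a part I on the primed atoms, written J ⊎ᴵ I below. Under J ⊎ᴵ I:
--
--   * a primed formula has the value of the formula under I (⟦primeᶠ⟧);
--   * τ φ has the value of the reduct of φ relative to I under J (⟦τ⟧), since
--     both evaluate negated subexpressions by I and all else by J;
--   * V < V' says that J is a proper subset of I, as far as V is concerned.
--
-- The quantifier over V lets J range over the subsets of V while I stays as it
-- is (exists-sound, exists-complete). Hence the second conjunct of 𝒮[Π] says
-- that no proper subset J of I is a model of the reduct. The first says that I
-- is a model of Π, equivalently of its reduct, because under I every expression
-- agrees with its reduct relative to I (⟦reductᴱ⟧).
--
-- Since QBF truth is defined by substitution of ⊤ and ⊥, it is first shown to
-- agree with an evaluation ⟦_⟧ˢ that updates the interpretation instead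
-- (truth-correct); the latter is compositional.

open import Defs
open import Data.Bool.Base as 𝔹 using (Bool; true; false)
open import Data.Bool.Properties using (¬-not; not-¬; not-injective; ∧-conicalˡ; ∧-conicalʳ)
open import Data.Empty using (⊥-elim)
open import Data.List.Base using (List; []; _∷_; map)
open import Data.List.Membership.Propositional using (_∈_; _∉_)
import Data.List.Membership.DecPropositional as DecMembership
open import Data.List.Membership.Propositional.Properties using (∈-map⁺; ∈-map⁻)
open import Data.List.Properties using (map-∘)
open import Data.List.Relation.Unary.Any using (here; there)
open import Data.Nat.Base using (suc; s≤s)
open import Data.Nat.Properties using (≤-refl)
open import Data.Product.Base using (∃; _×_; _,_; proj₁; proj₂)
open import Data.Sum.Base using (_⊎_; inj₁; inj₂)
import Data.Vec.Base as Vec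
open import Function.Base using (_∘_)
open import Function.Bundles using (_⇔_; mk⇔)
open import Level using (Level)
open import Relation.Binary.Definitions using (DecidableEquality)
open import Relation.Binary.PropositionalEquality
  using (_≡_; _≢_; _≗_; refl; sym; trans; cong; cong₂; module ≡-Reasoning)
open import Relation.Nullary using (yes; no) renaming (¬_ to ¬′_)

private
  variable
    a b : Level
    A : Set a
    B : Set b

-- Boolean connectives

∧-true : ∀ {x y} → x ≡ true → y ≡ true → x 𝔹.∧ y ≡ true
∧-true refl refl = refl

∨-true : ∀ {x y} → x 𝔹.∨ y ≡ true → x ≡ true ⊎ y ≡ true
∨-true {true}  _ = inj₁ refl
∨-true {false} h = inj₂ h

∨-trueˡ : ∀ {x y} → x ≡ true → x 𝔹.∨ y ≡ true
∨-trueˡ refl = refl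

∨-trueʳ : ∀ {x y} → y ≡ true → x 𝔹.∨ y ≡ true
∨-trueʳ {true}  _ = refl
∨-trueʳ {false} h = h

⊃-elim : ∀ {x y} → 𝔹.not x 𝔹.∨ y ≡ true → x ≡ true → y ≡ true
⊃-elim h refl = h

⊃-intro : ∀ {x y} → (x ≡ true → y ≡ true) → 𝔹.not x 𝔹.∨ y ≡ true
⊃-intro {true}  h = h refl
⊃-intro {false} h = refl

-- Compositional semantics of QBFs

module Semantics {a} {A : Set a} (_≟_ : DecidableEquality A) where

  open QBFSemantics _≟_

  -- The interpretation that gives p the value v and otherwise agrees with I.
  update : Interpretation A → A → Bool → Interpretation A
  update I p v q with p ≟ q
  ... | yes _ = v
  ... | no  _ = I q

  update-cong : ∀ {I J} p v → I ≗ J → update I p v ≗ update J p v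
  update-cong p v e q with p ≟ q
  ... | yes _ = refl
  ... | no  _ = e q

  update-overwrite : ∀ I p v w → update (update I p v) p w ≗ update I p w
  update-overwrite I p v w q with p ≟ q
  ... | yes _ = refl
  ... | no  p≢q with p ≟ q
  ...   | yes p≡q = ⊥-elim (p≢q p≡q)
  ...   | no  _   = refl

  update-comm : ∀ I {p q} v w → p ≢ q →
    update (update I p v) q w ≗ update (update I q w) p v
  update-comm I {p} {q} v w p≢q r with p ≟ r | q ≟ r
  ... | yes refl | yes refl = ⊥-elim (p≢q refl)
  ... | yes refl | no  _    with p ≟ p
  ...   | yes _   = refl
  ...   | no  p≢p = ⊥-elim (p≢p refl)
  update-comm I {p} {q} v w p≢q r | no _ | yes refl with q ≟ q
  ...   | yes _   = refl
  ...   | no  q≢q = ⊥-elim (q≢q refl)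
  update-comm I {p} {q} v w p≢q r | no p≢r | no q≢r with p ≟ r | q ≟ r
  ...   | yes p≡r | _       = ⊥-elim (p≢r p≡r)
  ...   | no  _   | yes q≡r = ⊥-elim (q≢r q≡r)
  ...   | no  _   | no  _   = refl

  -- The value of a QBF, with quantifiers ranging over updates of the
  -- interpretation.
  ⟦_⟧ˢ : QBF A → Interpretation A → Bool
  ⟦ atom p ⟧ˢ I  = I p
  ⟦ ⊤ ⟧ˢ I       = true
  ⟦ ⊥ ⟧ˢ I       = false
  ⟦ ¬ Φ ⟧ˢ I     = 𝔹.not (⟦ Φ ⟧ˢ I)
  ⟦ Φ ∧ Ψ ⟧ˢ I   = ⟦ Φ ⟧ˢ I 𝔹.∧ ⟦ Ψ ⟧ˢ I
  ⟦ Φ ∨ Ψ ⟧ˢ I   = ⟦ Φ ⟧ˢ I 𝔹.∨ ⟦ Ψ ⟧ˢ I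
  ⟦ Φ ⊃ Ψ ⟧ˢ I   = 𝔹.not (⟦ Φ ⟧ˢ I) 𝔹.∨ ⟦ Ψ ⟧ˢ I
  ⟦ all p Φ ⟧ˢ I = ⟦ Φ ⟧ˢ (update I p true) 𝔹.∧ ⟦ Φ ⟧ˢ (update I p false)
  ⟦ ex p Φ ⟧ˢ I  = ⟦ Φ ⟧ˢ (update I p true) 𝔹.∨ ⟦ Φ ⟧ˢ (update I p false)

  ⟦⟧ˢ-cong : ∀ Φ {I J} → I ≗ J → ⟦ Φ ⟧ˢ I ≡ ⟦ Φ ⟧ˢ J
  ⟦⟧ˢ-cong (atom p) e  = e p
  ⟦⟧ˢ-cong ⊤ e         = refl
  ⟦⟧ˢ-cong ⊥ e         = refl
  ⟦⟧ˢ-cong (¬ Φ) e     = cong 𝔹.not (⟦⟧ˢ-cong Φ e)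
  ⟦⟧ˢ-cong (Φ ∧ Ψ) e   = cong₂ 𝔹._∧_ (⟦⟧ˢ-cong Φ e) (⟦⟧ˢ-cong Ψ e)
  ⟦⟧ˢ-cong (Φ ∨ Ψ) e   = cong₂ 𝔹._∨_ (⟦⟧ˢ-cong Φ e) (⟦⟧ˢ-cong Ψ e)
  ⟦⟧ˢ-cong (Φ ⊃ Ψ) e   = cong₂ 𝔹._∨_ (cong 𝔹.not (⟦⟧ˢ-cong Φ e)) (⟦⟧ˢ-cong Ψ e)
  ⟦⟧ˢ-cong (all p Φ) e =
    cong₂ 𝔹._∧_ (⟦⟧ˢ-cong Φ (update-cong p true e)) (⟦⟧ˢ-cong Φ (update-cong p false e))
  ⟦⟧ˢ-cong (ex p Φ) e  =
    cong₂ 𝔹._∨_ (⟦⟧ˢ-cong Φ (update-cong p true e)) (⟦⟧ˢ-cong Φ (update-cong p false e))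

  -- Substituting a constant for p amounts to updating p. No capture can occur;
  -- where the quantifier binds p itself, its own update overrides the outer one.
  ⟦[/]⟧ˢ : ∀ Φ p v I → ⟦ Φ [ p / v ] ⟧ˢ I ≡ ⟦ Φ ⟧ˢ (update I p v)
  ⟦[/]⟧ˢ (atom q) p v I with p ≟ q
  ⟦[/]⟧ˢ (atom q) p true  I | yes _ = refl
  ⟦[/]⟧ˢ (atom q) p false I | yes _ = refl
  ⟦[/]⟧ˢ (atom q) p v     I | no  _ = refl
  ⟦[/]⟧ˢ ⊤ p v I       = refl
  ⟦[/]⟧ˢ ⊥ p v I       = refl
  ⟦[/]⟧ˢ (¬ Φ) p v I   = cong 𝔹.not (⟦[/]⟧ˢ Φ p v I)
  ⟦[/]⟧ˢ (Φ ∧ Ψ) p v I = cong₂ 𝔹._∧_ (⟦[/]⟧ˢ Φ p v I) (⟦[/]⟧ˢ Ψ p v I)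
  ⟦[/]⟧ˢ (Φ ∨ Ψ) p v I = cong₂ 𝔹._∨_ (⟦[/]⟧ˢ Φ p v I) (⟦[/]⟧ˢ Ψ p v I)
  ⟦[/]⟧ˢ (Φ ⊃ Ψ) p v I = cong₂ 𝔹._∨_ (cong 𝔹.not (⟦[/]⟧ˢ Φ p v I)) (⟦[/]⟧ˢ Ψ p v I)
  ⟦[/]⟧ˢ (all q Φ) p v I with p ≟ q
  ... | yes refl = sym (cong₂ 𝔹._∧_ (bound true) (bound false))
    where
    bound : ∀ w → ⟦ Φ ⟧ˢ (update (update I p v) p w) ≡ ⟦ Φ ⟧ˢ (update I p w)
    bound w = ⟦⟧ˢ-cong Φ (update-overwrite I p v w)
  ... | no p≢q = cong₂ 𝔹._∧_ (free true) (free false)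
    where
    free : ∀ w → ⟦ Φ [ p / v ] ⟧ˢ (update I q w) ≡ ⟦ Φ ⟧ˢ (update (update I p v) q w)
    free w = trans (⟦[/]⟧ˢ Φ p v (update I q w))
                   (sym (⟦⟧ˢ-cong Φ (update-comm I v w p≢q)))
  ⟦[/]⟧ˢ (ex q Φ) p v I with p ≟ q
  ... | yes refl = sym (cong₂ 𝔹._∨_ (bound true) (bound false))
    where
    bound : ∀ w → ⟦ Φ ⟧ˢ (update (update I p v) p w) ≡ ⟦ Φ ⟧ˢ (update I p w)
    bound w = ⟦⟧ˢ-cong Φ (update-overwrite I p v w)
  ... | no p≢q = cong₂ 𝔹._∨_ (free true) (free false)
    where
    free : ∀ w → ⟦ Φ [ p / v ] ⟧ˢ (update I q w) ≡ ⟦ Φ ⟧ˢ (update (update I p v) q w)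
    free w = trans (⟦[/]⟧ˢ Φ p v (update I q w))
                   (sym (⟦⟧ˢ-cong Φ (update-comm I v w p≢q)))

  truth-correct : ∀ I n Φ h → truth I n Φ h ≡ ⟦ Φ ⟧ˢ I
  truth-correct I n (atom p) h = refl
  truth-correct I n ⊤ h        = refl
  truth-correct I n ⊥ h        = refl
  truth-correct I n (¬ Φ) h    = cong 𝔹.not (truth-correct I n Φ h)
  truth-correct I n (Φ ∧ Ψ) h  =
    cong₂ 𝔹._∧_ (truth-correct I n Φ _) (truth-correct I n Ψ _)
  truth-correct I n (Φ ∨ Ψ) h  =
    cong₂ 𝔹._∨_ (truth-correct I n Φ _) (truth-correct I n Ψ _)
  truth-correct I n (Φ ⊃ Ψ) h  =
    cong₂ 𝔹._∨_ (cong 𝔹.not (truth-correct I n Φ _)) (truth-correct I n Ψ _)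
  truth-correct I (suc n) (all p Φ) (s≤s h) = cong₂ 𝔹._∧_
    (trans (truth-correct I n (Φ [ p / true ]) _) (⟦[/]⟧ˢ Φ p true I))
    (trans (truth-correct I n (Φ [ p / false ]) _) (⟦[/]⟧ˢ Φ p false I))
  truth-correct I (suc n) (ex p Φ) (s≤s h) = cong₂ 𝔹._∨_
    (trans (truth-correct I n (Φ [ p / true ]) _) (⟦[/]⟧ˢ Φ p true I))
    (trans (truth-correct I n (Φ [ p / false ]) _) (⟦[/]⟧ˢ Φ p false I))

  ⟦toQBF⟧ˢ : ∀ φ I → ⟦ toQBF φ ⟧ˢ I ≡ ⟦ φ ⟧ I
  ⟦toQBF⟧ˢ (atom p) I = refl
  ⟦toQBF⟧ˢ ⊤ I        = refl
  ⟦toQBF⟧ˢ ⊥ I        = refl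
  ⟦toQBF⟧ˢ (¬ φ) I    = cong 𝔹.not (⟦toQBF⟧ˢ φ I)
  ⟦toQBF⟧ˢ (φ ∧ ψ) I  = cong₂ 𝔹._∧_ (⟦toQBF⟧ˢ φ I) (⟦toQBF⟧ˢ ψ I)
  ⟦toQBF⟧ˢ (φ ∨ ψ) I  = cong₂ 𝔹._∨_ (⟦toQBF⟧ˢ φ I) (⟦toQBF⟧ˢ ψ I)
  ⟦toQBF⟧ˢ (φ ⊃ ψ) I  = cong₂ 𝔹._∨_ (cong 𝔹.not (⟦toQBF⟧ˢ φ I)) (⟦toQBF⟧ˢ ψ I)

  infix 4 _≗_outside_

  -- J and I give the same value to every atom that is not in P.
  _≗_outside_ : Interpretation A → Interpretation A → List A → Set a
  J ≗ I outside P = ∀ p → p ∉ P → J p ≡ I p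

  update-outside : ∀ {I p} v {q} → q ≢ p → update I p v q ≡ I q
  update-outside {p = p} v {q} q≢p with p ≟ q
  ... | yes p≡q = ⊥-elim (q≢p (sym p≡q))
  ... | no  _   = refl

  outside-drop : ∀ {I J p P} v → J ≗ update I p v outside P → J ≗ I outside (p ∷ P)
  outside-drop v e q q∉ =
    trans (e q (q∉ ∘ there)) (update-outside v (q∉ ∘ here))

  -- The atom p may be given the value J p before the remaining atoms are chosen.
  outside-take : ∀ {I J p P} → J ≗ I outside (p ∷ P) → J ≗ update I p (J p) outside P
  outside-take {p = p} e q q∉ with p ≟ q
  ... | yes refl = refl
  ... | no  p≢q  = e q λ { (here q≡p) → p≢q (sym q≡p) ; (there q∈) → q∉ q∈ }

  exists-sound : ∀ P Φ I → ⟦ exists P Φ ⟧ˢ I ≡ true →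
    ∃ λ J → (J ≗ I outside P) × ⟦ Φ ⟧ˢ J ≡ true
  exists-sound [] Φ I h = I , (λ _ _ → refl) , h
  exists-sound (p ∷ P) Φ I h with ∨-true h
  ... | inj₁ t = let J , e , k = exists-sound P Φ (update I p true) t
                 in J , outside-drop true e , k
  ... | inj₂ f = let J , e , k = exists-sound P Φ (update I p false) f
                 in J , outside-drop false e , k

  exists-complete : ∀ P Φ I J → J ≗ I outside P → ⟦ Φ ⟧ˢ J ≡ true → ⟦ exists P Φ ⟧ˢ I ≡ true
  exists-complete [] Φ I J e k = trans (sym (⟦⟧ˢ-cong Φ (λ p → e p λ ()))) k
  exists-complete (p ∷ P) Φ I J e k
    with J p | exists-complete P Φ (update I p (J p)) J (outside-take e) k
  ... | true  | t = ∨-trueˡ t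
  ... | false | f = ∨-trueʳ f

-- Conjunctions

⋀-cong : ∀ {C : Set a} {A : Set b} {B : Set b} {f : C → Formula A} {g : C → Formula B} {I J} →
  (∀ x → ⟦ f x ⟧ I ≡ ⟦ g x ⟧ J) → ∀ xs → ⟦ ⋀ (map f xs) ⟧ I ≡ ⟦ ⋀ (map g xs) ⟧ J
⋀-cong e []       = refl
⋀-cong e (x ∷ xs) = cong₂ 𝔹._∧_ (e x) (⋀-cong e xs)

-- S ≤ T for families S and T of formulas indexed by a list.
module _ {f g : A → Formula B} {I : Interpretation B} where

  private
    _≤ᵛ_ : (A → Formula B) → (A → Formula B) → List A → Formula B
    (f ≤ᵛ g) xs = Vec.map f (Vec.fromList xs) ≤ Vec.map g (Vec.fromList xs)

  ≤-elim : ∀ xs → I ⊨ (f ≤ᵛ g) xs → ∀ {x} → x ∈ xs → I ⊨ f x → I ⊨ g x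
  ≤-elim (x ∷ xs) h (here refl) = ⊃-elim (∧-conicalˡ _ _ h)
  ≤-elim (x ∷ xs) h (there x∈)  = ≤-elim xs (∧-conicalʳ _ _ h) x∈

  ≤-intro : ∀ xs → (∀ {x} → x ∈ xs → I ⊨ f x → I ⊨ g x) → I ⊨ (f ≤ᵛ g) xs
  ≤-intro []       h = refl
  ≤-intro (x ∷ xs) h = ∧-true (⊃-intro (h (here refl))) (≤-intro xs (h ∘ there))

-- Interpretations of the extended alphabet

infixr 5 _⊎ᴵ_

-- J on the original atoms, I on the primed ones.
_⊎ᴵ_ : Interpretation A → Interpretation A → Interpretation (Primed A)
(J ⊎ᴵ I) ⌊ p ⌋ = J p
(J ⊎ᴵ I) (p ′) = I p

-- Here K is any interpretation that is I on the primed atoms, so that both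
-- J ⊎ᴵ I and primeᴵ I are covered.
module _ (K : Interpretation (Primed A)) (I : Interpretation A) (K-′ : ∀ p → K (p ′) ≡ I p) where

  ⟦primeᶠ⟧ : ∀ φ → ⟦ primeᶠ φ ⟧ K ≡ ⟦ φ ⟧ I
  ⟦primeᶠ⟧ (atom p) = K-′ p
  ⟦primeᶠ⟧ ⊤        = refl
  ⟦primeᶠ⟧ ⊥        = refl
  ⟦primeᶠ⟧ (¬ φ)    = cong 𝔹.not (⟦primeᶠ⟧ φ)
  ⟦primeᶠ⟧ (φ ∧ ψ)  = cong₂ 𝔹._∧_ (⟦primeᶠ⟧ φ) (⟦primeᶠ⟧ ψ)
  ⟦primeᶠ⟧ (φ ∨ ψ)  = cong₂ 𝔹._∨_ (⟦primeᶠ⟧ φ) (⟦primeᶠ⟧ ψ)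
  ⟦primeᶠ⟧ (φ ⊃ ψ)  = cong₂ 𝔹._∨_ (cong 𝔹.not (⟦primeᶠ⟧ φ)) (⟦primeᶠ⟧ ψ)

⌜primeᴱ⌝ : (φ : Expr A) → ⌜ primeᴱ φ ⌝ ≡ primeᶠ ⌜ φ ⌝
⌜primeᴱ⌝ (atom p) = refl
⌜primeᴱ⌝ ⊤        = refl
⌜primeᴱ⌝ ⊥        = refl
⌜primeᴱ⌝ (¬ φ)    = cong ¬_ (⌜primeᴱ⌝ φ)
⌜primeᴱ⌝ (φ ∧ ψ)  = cong₂ _∧_ (⌜primeᴱ⌝ φ) (⌜primeᴱ⌝ ψ)
⌜primeᴱ⌝ (φ ∨ ψ)  = cong₂ _∨_ (⌜primeᴱ⌝ φ) (⌜primeᴱ⌝ ψ)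

module _ (I : Interpretation A) where

  ⟦reductᴱ-¬⟧ : ∀ ψ J → ⟦ ⌜ reductᴱ I (¬ ψ) ⌝ ⟧ J ≡ 𝔹.not (⟦ ⌜ ψ ⌝ ⟧ I)
  ⟦reductᴱ-¬⟧ ψ J with ⟦ ⌜ ψ ⌝ ⟧ I
  ... | true  = refl
  ... | false = refl

  ⟦reductᴱ⟧ : ∀ φ → ⟦ ⌜ reductᴱ I φ ⌝ ⟧ I ≡ ⟦ ⌜ φ ⌝ ⟧ I
  ⟦reductᴱ⟧ (atom p) = refl
  ⟦reductᴱ⟧ ⊤        = refl
  ⟦reductᴱ⟧ ⊥        = refl
  ⟦reductᴱ⟧ (¬ ψ)    = ⟦reductᴱ-¬⟧ ψ I
  ⟦reductᴱ⟧ (φ ∧ ψ)  = cong₂ 𝔹._∧_ (⟦reductᴱ⟧ φ) (⟦reductᴱ⟧ ψ)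
  ⟦reductᴱ⟧ (φ ∨ ψ)  = cong₂ 𝔹._∨_ (⟦reductᴱ⟧ φ) (⟦reductᴱ⟧ ψ)

  ⟦τ⟧ : ∀ J φ → ⟦ ⌜ τ φ ⌝ ⟧ (J ⊎ᴵ I) ≡ ⟦ ⌜ reductᴱ I φ ⌝ ⟧ J
  ⟦τ⟧ J (atom p) = refl
  ⟦τ⟧ J ⊤        = refl
  ⟦τ⟧ J ⊥        = refl
  ⟦τ⟧ J (¬ ψ)    = trans
    (cong 𝔹.not (trans (cong (λ χ → ⟦ χ ⟧ (J ⊎ᴵ I)) (⌜primeᴱ⌝ ψ))
                       (⟦primeᶠ⟧ (J ⊎ᴵ I) I (λ _ → refl) ⌜ ψ ⌝)))
    (sym (⟦reductᴱ-¬⟧ ψ J))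
  ⟦τ⟧ J (φ ∧ ψ)  = cong₂ 𝔹._∧_ (⟦τ⟧ J φ) (⟦τ⟧ J ψ)
  ⟦τ⟧ J (φ ∨ ψ)  = cong₂ 𝔹._∨_ (⟦τ⟧ J φ) (⟦τ⟧ J ψ)

-- The program, its reduct and its translation

module _ (Π : Program A) (I : Interpretation A) where

  private
    ruleFormula : Rule A → Formula A
    ruleFormula r = ⌜ body r ⌝ ⊃ ⌜ head r ⌝

    reductRule : Rule A → Rule A
    reductRule r = reductᴱ I (head r) ← reductᴱ I (body r)

    ⟦⊃⟧ : ∀ {x x' y y'} → x ≡ x' → y ≡ y' → 𝔹.not x 𝔹.∨ y ≡ 𝔹.not x' 𝔹.∨ y'
    ⟦⊃⟧ = cong₂ (λ x y → 𝔹.not x 𝔹.∨ y)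

    hat-reduct : hat (reduct I Π) ≡ map (ruleFormula ∘ reductRule) Π
    hat-reduct = sym (map-∘ Π)

  -- The first conjunct: the primed program holds under I' iff I is a model of
  -- the reduct.
  ⟦hat-primed⟧ : ⟦ ⋀ (map primeᶠ (hat Π)) ⟧ (primeᴵ I) ≡ ⟦ ⋀ (hat (reduct I Π)) ⟧ I
  ⟦hat-primed⟧ = begin
    ⟦ ⋀ (map primeᶠ (hat Π)) ⟧ (primeᴵ I)
      ≡⟨ cong (λ φs → ⟦ ⋀ φs ⟧ (primeᴵ I)) (sym (map-∘ Π)) ⟩
    ⟦ ⋀ (map (primeᶠ ∘ ruleFormula) Π) ⟧ (primeᴵ I)
      ≡⟨ ⋀-cong (λ r → trans (⟦primeᶠ⟧ (primeᴵ I) I (λ _ → refl) (ruleFormula r))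
                         (sym (⟦⊃⟧ (⟦reductᴱ⟧ I (body r)) (⟦reductᴱ⟧ I (head r))))) Π ⟩
    ⟦ ⋀ (map (ruleFormula ∘ reductRule) Π) ⟧ I
      ≡⟨ cong (λ φs → ⟦ ⋀ φs ⟧ I) (sym hat-reduct) ⟩
    ⟦ ⋀ (hat (reduct I Π)) ⟧ I ∎
    where open ≡-Reasoning

  ⟦τ-rules⟧ : ∀ J →
    ⟦ ⋀ (map (λ r → ⌜ τ (body r) ⌝ ⊃ ⌜ τ (head r) ⌝) Π) ⟧ (J ⊎ᴵ I) ≡ ⟦ ⋀ (hat (reduct I Π)) ⟧ J
  ⟦τ-rules⟧ J = trans
    (⋀-cong (λ r → ⟦⊃⟧ (⟦τ⟧ I J (body r)) (⟦τ⟧ I J (head r))) Π)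
    (cong (λ φs → ⟦ ⋀ φs ⟧ J) (sym hat-reduct))

-- The formula V < V', and what it says about J ⊎ᴵ I.
below : List A → Formula (Primed A)
below V = Vec.map (λ p → atom ⌊ p ⌋) (Vec.fromList V) < Vec.map (λ p → atom (p ′)) (Vec.fromList V)

module _ {I J : Interpretation A} (V : List A) where

  -- V < V' does not constrain atoms outside V, so J ⊆ᴸ V is needed for J ⊆ I.
  below-elim : (J ⊎ᴵ I) ⊨ below V → J ⊆ᴸ V → (J ⊆ I) × ¬′ (I ⊆ J)
  below-elim h J⊆V =
      (λ Jp → ≤-elim V (∧-conicalˡ _ _ h) (J⊆V Jp) Jp)
    , λ I⊆J → not-¬ (≤-intro V λ _ → I⊆J) (not-injective (∧-conicalʳ _ _ h))

  below-intro : J ⊆ I → ∀ {p} → p ∈ V → p ∈ᴵ I → J p ≡ false → (J ⊎ᴵ I) ⊨ below V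
  below-intro J⊆I p∈V Ip ¬Jp = ∧-true
    (≤-intro V λ _ → J⊆I)
    (cong 𝔹.not (¬-not λ I≤J → not-¬ (≤-elim V I≤J p∈V Ip) ¬Jp))

-- Stable models as models of the encoding

theorem2 : ∀ {a} {A : Set a} (_≟_ : DecidableEquality A) (let open QBFSemantics (primed-≟ _≟_)) →
    (Π : Program A) (I : Interpretation A) → I ⊆ᴸ var _≟_ Π →
    IsStableModel I Π ⇔ (primeᴵ I ⊨ꟴ 𝒮[ _≟_ ] Π)
theorem2 {A = A} _≟_ Π I I⊆V = mk⇔
  (λ (model , minimal) → trans ⟦𝒮⟧ (∧-true model (cong 𝔹.not (¬-not (no-smaller minimal)))))
  (λ h → let h′ = trans (sym ⟦𝒮⟧) h
         in ∧-conicalˡ _ _ h′ , λ J model J⊆I → contains (∧-conicalʳ _ _ h′) J model J⊆I)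
  where
  open QBFSemantics (primed-≟ _≟_)
  open Semantics (primed-≟ _≟_)
  open DecMembership _≟_ using (_∈?_)

  V = var _≟_ Π

  rules matrix : Formula (Primed A)
  rules  = ⋀ (map (λ r → ⌜ τ (body r) ⌝ ⊃ ⌜ τ (head r) ⌝) Π)
  matrix = below V ∧ rules

  -- Under primeᴵ I: some proper subset of I is a model of the reduct.
  smaller : QBF (Primed A)
  smaller = exists (map ⌊_⌋ V) (toQBF matrix)

  ⟦𝒮⟧ : ⟦ 𝒮[ _≟_ ] Π ⟧ꟴ (primeᴵ I) ≡
        ⟦ ⋀ (hat (reduct I Π)) ⟧ I 𝔹.∧ 𝔹.not (⟦ smaller ⟧ˢ (primeᴵ I))
  ⟦𝒮⟧ = trans (truth-correct (primeᴵ I) _ (𝒮[ _≟_ ] Π) ≤-refl)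
    (cong (𝔹._∧ 𝔹.not (⟦ smaller ⟧ˢ (primeᴵ I)))
      (trans (⟦toQBF⟧ˢ (⋀ (map primeᶠ (hat Π))) (primeᴵ I)) (⟦hat-primed⟧ Π I)))

  no-smaller : (∀ J → IsModel J (reduct I Π) → J ⊆ I → I ⊆ J) →
    ¬′ (⟦ smaller ⟧ˢ (primeᴵ I) ≡ true)
  no-smaller minimal h with exists-sound (map ⌊_⌋ V) (toQBF matrix) (primeᴵ I) h
  ... | K , K-outside , k = I⊈J (minimal J J-model J⊆I)
    where
    J : Interpretation A
    J p = K ⌊ p ⌋

    -- Primed atoms are not quantified, so K leaves them as they are in I.
    K≗J⊎I : K ≗ J ⊎ᴵ I
    K≗J⊎I ⌊ p ⌋ = refl
    K≗J⊎I (p ′) = K-outside (p ′) λ p′∈ → not-unprimed (∈-map⁻ ⌊_⌋ p′∈)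
      where
      not-unprimed : ¬′ (∃ λ q → q ∈ V × p ′ ≡ ⌊ q ⌋)
      not-unprimed (_ , _ , ())

    -- Original atoms outside V are not quantified either, and primeᴵ I makes
    -- them false.
    J⊆V : J ⊆ᴸ V
    J⊆V {p} Jp with p ∈? V
    ... | yes p∈V = p∈V
    ... | no  p∉V = ⊥-elim (not-¬ Jp (K-outside ⌊ p ⌋ λ p∈ → outside (∈-map⁻ ⌊_⌋ p∈)))
      where
      outside : ¬′ (∃ λ q → q ∈ V × ⌊ p ⌋ ≡ ⌊ q ⌋)
      outside (_ , q∈V , refl) = p∉V q∈V

    matrix-true : (J ⊎ᴵ I) ⊨ matrix
    matrix-true = trans (sym (⟦toQBF⟧ˢ matrix (J ⊎ᴵ I)))
                    (trans (sym (⟦⟧ˢ-cong (toQBF matrix) K≗J⊎I)) k)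

    J-model : IsModel J (reduct I Π)
    J-model = trans (sym (⟦τ-rules⟧ Π I J)) (∧-conicalʳ _ _ matrix-true)

    J⊂I : (J ⊆ I) × ¬′ (I ⊆ J)
    J⊂I = below-elim V (∧-conicalˡ _ _ matrix-true) J⊆V

    J⊆I : J ⊆ I
    J⊆I = proj₁ J⊂I

    I⊈J : ¬′ (I ⊆ J)
    I⊈J = proj₂ J⊂I

  contains : 𝔹.not (⟦ smaller ⟧ˢ (primeᴵ I)) ≡ true →
    ∀ J → IsModel J (reduct I Π) → J ⊆ I → I ⊆ J
  contains h J model J⊆I {p} Ip with J p in Jp
  ... | true  = refl
  ... | false = ⊥-elim (not-¬ smaller-true (not-injective h))
    where
    agree : J ⊎ᴵ I ≗ primeᴵ I outside map ⌊_⌋ V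
    agree ⌊ q ⌋ q∉ = ¬-not λ Jq → q∉ (∈-map⁺ ⌊_⌋ (I⊆V (J⊆I Jq)))
    agree (q ′) _  = refl

    matrix-true : (J ⊎ᴵ I) ⊨ matrix
    matrix-true = ∧-true (below-intro V J⊆I (I⊆V Ip) Ip Jp) (trans (⟦τ-rules⟧ Π I J) model)

    smaller-true : ⟦ smaller ⟧ˢ (primeᴵ I) ≡ true
    smaller-true = exists-complete (map ⌊_⌋ V) (toQBF matrix) (primeᴵ I) (J ⊎ᴵ I) agree
      (trans (⟦toQBF⟧ˢ matrix (J ⊎ᴵ I)) matrix-true)
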